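{- Let $\mathcal{B}$ be a swap structure for $\mathbf{LFI1}_\circ$. Then there exist a set $I$ and a monomorphism of algebras $\hat h:\mathcal{B}\to\prod_{i\in I}\mathcal{B}_{\mathbb{A}_2}^{\mathbf{LFI1}_\circ}$.
   Context: Let $\Sigma=\{\wedge,\vee,\to,\neg,\circ\}$, with $\wedge,\vee,\to$ binary and $\neg,\circ$ unary. For a Boolean algebra $\mathcal{A}$ with domain $A$ (the one-element Boolean algebra is allowed), with complement $\sim$, put $\mathrm{B}_{\mathcal{A}}^{\mathbf{ciw}}=\{(z_1,z_2)\in A^2 : z_1\vee z_2=1\}$. A swap structure for $\mathbf{LFI1}_\circ$ over $\mathcal{A}$ is a multialgebra over $\Sigma$ (a set with operations whose values are nonempty subsets) with domain $B\subseteq\mathrm{B}_{\mathcal{A}}^{\mathbf{ciw}}$, such that $0\in\{z_1:(z_1,z_2)\in B\}$, whose multioperations are single-valued and given, for all $(z_1,z_2),(w_1,w_2)\in B$, by - $(z_1,z_2)\wedge(w_1,w_2)=\{(z_1\wedge w_1,\ z_2\vee w_2)\}$; - $(z_1,z_2)\vee(w_1,w_2)=\{(z_1\vee w_1,\ z_2\wedge w_2)\}$; - $(z_1,z_2)\to(w_1,w_2)=\{(z_1\to w_1,\ z_1\wedge w_2)\}$; - $\neg(z_1,z_2)=\{(z_2,z_1)\}$; - $\circ(z_1,z_2)=\{({\sim}(z_1\wedge z_2),\ z_1\wedge z_2)\}$. Being single-valued, such structures are regarded as ordinary algebras over $\Sigma$ (identifying a singleton with its element); monomorphisms of algebras are injective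 homomorphisms, and products are direct products. A swap structure for $\mathbf{LFI1}_\circ$ is one over some Boolean algebra $\mathcal{A}$, and $\mathcal{B}_{\mathcal{A}}^{\mathbf{LFI1}_\circ}$ denotes the one with full domain $\mathrm{B}_{\mathcal{A}}^{\mathbf{ciw}}$. $\mathbb{A}_2$ is the two-element Boolean algebra (so $\mathcal{B}_{\mathbb{A}_2}^{\mathbf{LFI1}_\circ}$ has the three elements $(1,0),(1,1),(0,1)$). -}

module Defs where

open import Algebra.Core using (Op₁; Op₂)
open import Algebra.Definitions using (Congruent₁; Congruent₂)
open import Algebra.Lattice.Bundles using (BooleanAlgebra)
import Algebra.Lattice.Properties.BooleanAlgebra as BooleanAlgebraProperties
import Algebra.Morphism.Definitions as MorphismDefinitions
open import Data.Bool.Properties using (∨-∧-booleanAlgebra)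
open import Data.Product using (Σ; _×_; _,_; proj₁; proj₂; ∃)
open import Data.Product.Relation.Binary.Pointwise.NonDependent
  using (Pointwise; ×-isEquivalence)
open import Function.Base using (_on_)
open import Function.Definitions using (Congruent; Injective)
open import Level using (Level; 0ℓ; suc; _⊔_)
open import Relation.Binary.Core using (Rel)
open import Relation.Binary.Definitions using (_Respects_)
open import Relation.Binary.Structures using (IsEquivalence)
import Relation.Binary.Construct.On as On
import Relation.Binary.Reasoning.Setoid as SetoidReasoning
open import Relation.Unary using (Pred)

private
  variable
    a b c i ℓ ℓ₁ ℓ₂ p : Level

-- Algebras over Σ = {∧, ∨, →, ¬, ∘}; no equations are imposed.  The names are
-- _∧_, _∨_, _⇒_, neg, circ, and sets are setoids, as in the algebraic hierarchy
-- of the standard library.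

record ΣAlgebra c ℓ : Set (suc (c ⊔ ℓ)) where
  infixr 7 _∧_
  infixr 6 _∨_
  infixr 5 _⇒_
  infix  4 _≈_
  field
    Carrier       : Set c
    _≈_           : Rel Carrier ℓ
    isEquivalence : IsEquivalence _≈_
    _∧_           : Op₂ Carrier
    _∨_           : Op₂ Carrier
    _⇒_           : Op₂ Carrier
    neg           : Op₁ Carrier
    circ          : Op₁ Carrier
    ∧-cong        : Congruent₂ _≈_ _∧_
    ∨-cong        : Congruent₂ _≈_ _∨_
    ⇒-cong        : Congruent₂ _≈_ _⇒_
    neg-cong      : Congruent₁ _≈_ neg
    circ-cong     : Congruent₁ _≈_ circ

record IsHomomorphism (𝑨 : ΣAlgebra a ℓ₁) (𝑩 : ΣAlgebra b ℓ₂)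
  (h : ΣAlgebra.Carrier 𝑨 → ΣAlgebra.Carrier 𝑩) : Set (a ⊔ b ⊔ ℓ₁ ⊔ ℓ₂) where
  private
    module A = ΣAlgebra 𝑨
    module B = ΣAlgebra 𝑩
  open MorphismDefinitions A.Carrier B.Carrier B._≈_
  field
    cong      : Congruent A._≈_ B._≈_ h
    ∧-homo    : Homomorphic₂ h A._∧_ B._∧_
    ∨-homo    : Homomorphic₂ h A._∨_ B._∨_
    ⇒-homo    : Homomorphic₂ h A._⇒_ B._⇒_
    neg-homo  : Homomorphic₁ h A.neg B.neg
    circ-homo : Homomorphic₁ h A.circ B.circ

record IsMonomorphism (𝑨 : ΣAlgebra a ℓ₁) (𝑩 : ΣAlgebra b ℓ₂)
  (h : ΣAlgebra.Carrier 𝑨 → ΣAlgebra.Carrier 𝑩) : Set (a ⊔ b ⊔ ℓ₁ ⊔ ℓ₂) where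
  field
    isHomomorphism : IsHomomorphism 𝑨 𝑩 h
    injective      : Injective (ΣAlgebra._≈_ 𝑨) (ΣAlgebra._≈_ 𝑩) h

∏ : (I : Set i) → (I → ΣAlgebra c ℓ) → ΣAlgebra (i ⊔ c) (i ⊔ ℓ)
∏ I 𝑨 = record
  { Carrier       = ∀ k → A.Carrier k
  ; _≈_           = λ x y → ∀ k → A._≈_ k (x k) (y k)
  ; isEquivalence = record
    { refl  = λ k → IsEquivalence.refl (A.isEquivalence k)
    ; sym   = λ x≈y k → IsEquivalence.sym (A.isEquivalence k) (x≈y k)
    ; trans = λ x≈y y≈z k → IsEquivalence.trans (A.isEquivalence k) (x≈y k) (y≈z k)
    }
  ; _∧_           = λ x y k → A._∧_ k (x k) (y k)
  ; _∨_           = λ x y k → A._∨_ k (x k) (y k)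
  ; _⇒_           = λ x y k → A._⇒_ k (x k) (y k)
  ; neg           = λ x k → A.neg k (x k)
  ; circ          = λ x k → A.circ k (x k)
  ; ∧-cong        = λ x≈y u≈v k → A.∧-cong k (x≈y k) (u≈v k)
  ; ∨-cong        = λ x≈y u≈v k → A.∨-cong k (x≈y k) (u≈v k)
  ; ⇒-cong        = λ x≈y u≈v k → A.⇒-cong k (x≈y k) (u≈v k)
  ; neg-cong      = λ x≈y k → A.neg-cong k (x≈y k)
  ; circ-cong     = λ x≈y k → A.circ-cong k (x≈y k)
  }
  where module A k = ΣAlgebra (𝑨 k)

-- Note that BooleanAlgebra does not require ⊥ ≉ ⊤.

module Snapshots (𝓐 : BooleanAlgebra c ℓ) where
  open BooleanAlgebra 𝓐

  Pair : Set c
  Pair = Carrier × Carrier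

  _≈ᵖ_ : Rel Pair ℓ
  _≈ᵖ_ = Pointwise _≈_ _≈_

  _∧ᵖ_ _∨ᵖ_ _⇒ᵖ_ : Op₂ Pair
  (z₁ , z₂) ∧ᵖ (w₁ , w₂) = (z₁ ∧ w₁) , (z₂ ∨ w₂)
  (z₁ , z₂) ∨ᵖ (w₁ , w₂) = (z₁ ∨ w₁) , (z₂ ∧ w₂)
  (z₁ , z₂) ⇒ᵖ (w₁ , w₂) = (¬ z₁ ∨ w₁) , (z₁ ∧ w₂)

  negᵖ circᵖ : Op₁ Pair
  negᵖ  (z₁ , z₂) = z₂ , z₁
  circᵖ (z₁ , z₂) = ¬ (z₁ ∧ z₂) , (z₁ ∧ z₂)

  Bciw : Pred Pair ℓ
  Bciw (z₁ , z₂) = z₁ ∨ z₂ ≈ ⊤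

-- The multioperations of a swap structure for LFI1∘ are single-valued and
-- prescribed on the whole domain, so such a structure amounts to a domain that
-- contains their values.

record SwapStructure (𝓐 : BooleanAlgebra c ℓ) p : Set (c ⊔ ℓ ⊔ suc p) where
  open BooleanAlgebra 𝓐 using (⊥)
  open Snapshots 𝓐
  field
    Domain      : Pred Pair p
    respects    : Domain Respects _≈ᵖ_
    domain⊆     : ∀ {z} → Domain z → Bciw z
    0∈proj₁     : ∃ λ z₂ → Domain (⊥ , z₂)
    ∧-closed    : ∀ {z w} → Domain z → Domain w → Domain (z ∧ᵖ w)
    ∨-closed    : ∀ {z w} → Domain z → Domain w → Domain (z ∨ᵖ w)
    ⇒-closed    : ∀ {z w} → Domain z → Domain w → Domain (z ⇒ᵖ w)
    neg-closed  : ∀ {z} → Domain z → Domain (negᵖ z)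
    circ-closed : ∀ {z} → Domain z → Domain (circᵖ z)

-- Elements of the domain are compared by their underlying pairs only.

algebra : {𝓐 : BooleanAlgebra c ℓ} → SwapStructure 𝓐 p → ΣAlgebra (c ⊔ p) ℓ
algebra {𝓐 = 𝓐} B = record
  { Carrier       = Σ Pair Domain
  ; _≈_           = _≈ᵖ_ on proj₁
  ; isEquivalence = On.isEquivalence proj₁ (×-isEquivalence A.isEquivalence A.isEquivalence)
  ; _∧_           = λ (z , d) (w , e) → (z ∧ᵖ w) , ∧-closed d e
  ; _∨_           = λ (z , d) (w , e) → (z ∨ᵖ w) , ∨-closed d e
  ; _⇒_           = λ (z , d) (w , e) → (z ⇒ᵖ w) , ⇒-closed d e
  ; neg           = λ (z , d) → negᵖ z , neg-closed d
  ; circ          = λ (z , d) → circᵖ z , circ-closed d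
  ; ∧-cong        = λ (p , q) (r , s) → A.∧-cong p r , A.∨-cong q s
  ; ∨-cong        = λ (p , q) (r , s) → A.∨-cong p r , A.∧-cong q s
  ; ⇒-cong        = λ (p , q) (r , s) → A.∨-cong (A.¬-cong p) r , A.∧-cong p s
  ; neg-cong      = λ (p , q) → q , p
  ; circ-cong     = λ (p , q) → A.¬-cong (A.∧-cong p q) , A.∧-cong p q
  }
  where
  module A = BooleanAlgebra 𝓐
  open Snapshots 𝓐
  open SwapStructure B

fullSwapStructure : (𝓐 : BooleanAlgebra c ℓ) → SwapStructure 𝓐 ℓ
fullSwapStructure 𝓐 = record
  { Domain      = Bciw
  ; respects    = λ (p , q) z∈ → trans (∨-cong (sym p) (sym q)) z∈
  ; domain⊆     = λ z∈ → z∈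
  ; 0∈proj₁     = ⊤ , ∨-zeroʳ ⊥
  ; ∧-closed    = full-∧
  ; ∨-closed    = λ {z} {w} z∈ w∈ →
      trans (∨-comm _ _)
            (full-∧ {negᵖ z} {negᵖ w} (trans (∨-comm _ _) z∈) (trans (∨-comm _ _) w∈))
  ; ⇒-closed    = full-⇒
  ; neg-closed  = λ z∈ → trans (∨-comm _ _) z∈
  ; circ-closed = λ _ → ∨-complementˡ _
  }
  where
  open BooleanAlgebra 𝓐
  open BooleanAlgebraProperties 𝓐 using (∨-zeroʳ; ∨-zeroˡ; ∧-identityˡ)
  open Snapshots 𝓐
  open SetoidReasoning setoid

  full-∧ : ∀ {z w} → Bciw z → Bciw w → Bciw (z ∧ᵖ w)
  full-∧ {z₁ , z₂} {w₁ , w₂} z∈ w∈ = begin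
    (z₁ ∧ w₁) ∨ (z₂ ∨ w₂)                 ≈⟨ ∨-distribʳ-∧ _ _ _ ⟩
    (z₁ ∨ (z₂ ∨ w₂)) ∧ (w₁ ∨ (z₂ ∨ w₂))   ≈⟨ ∧-cong (∨-assoc _ _ _) (∨-cong refl (∨-comm _ _)) ⟨
    ((z₁ ∨ z₂) ∨ w₂) ∧ (w₁ ∨ (w₂ ∨ z₂))   ≈⟨ ∧-cong (∨-cong z∈ refl) (sym (∨-assoc _ _ _)) ⟩
    (⊤ ∨ w₂) ∧ ((w₁ ∨ w₂) ∨ z₂)           ≈⟨ ∧-cong (∨-zeroˡ _) (∨-cong w∈ refl) ⟩
    ⊤ ∧ (⊤ ∨ z₂)                          ≈⟨ ∧-identityˡ _ ⟩
    ⊤ ∨ z₂                                ≈⟨ ∨-zeroˡ _ ⟩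
    ⊤                                     ∎

  full-⇒ : ∀ {z w} → Bciw z → Bciw w → Bciw (z ⇒ᵖ w)
  full-⇒ {z₁ , z₂} {w₁ , w₂} z∈ w∈ = begin
    (¬ z₁ ∨ w₁) ∨ (z₁ ∧ w₂)                    ≈⟨ ∨-distribˡ-∧ _ _ _ ⟩
    ((¬ z₁ ∨ w₁) ∨ z₁) ∧ ((¬ z₁ ∨ w₁) ∨ w₂)    ≈⟨ ∧-cong (∨-cong (∨-comm _ _) refl) (∨-assoc _ _ _) ⟩
    ((w₁ ∨ ¬ z₁) ∨ z₁) ∧ (¬ z₁ ∨ (w₁ ∨ w₂))    ≈⟨ ∧-cong (∨-assoc _ _ _) (∨-cong refl w∈) ⟩
    (w₁ ∨ (¬ z₁ ∨ z₁)) ∧ (¬ z₁ ∨ ⊤)            ≈⟨ ∧-cong (∨-cong refl (∨-complementˡ _)) (∨-zeroʳ _) ⟩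
    (w₁ ∨ ⊤) ∧ ⊤                               ≈⟨ ∧-cong (∨-zeroʳ _) refl ⟩
    ⊤ ∧ ⊤                                      ≈⟨ ∧-identityˡ _ ⟩
    ⊤                                          ∎

𝔸₂ : BooleanAlgebra 0ℓ 0ℓ
𝔸₂ = ∨-∧-booleanAlgebra

𝓑-LFI1∘ : BooleanAlgebra c ℓ → ΣAlgebra (c ⊔ ℓ) ℓ
𝓑-LFI1∘ 𝓐 = algebra (fullSwapStructure 𝓐)

{-# OPTIONS --safe #-}
module Submission where

-- A snapshot (z₁ , z₂) is sent to the family of its images (χ z₁ , χ z₂) under
-- all Boolean homomorphisms χ : 𝓐 → 𝔸₂.  All operations are Boolean in each
-- coordinate, so this is a homomorphism; it is injective because ultrafilters
-- separate the points of 𝓐.  Ultrafilters come from Zorn's lemma for families of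
-- subsets, proved by the tower construction of Bourbaki and Witt.

open import Defs
open import Level using (Level; Lift; lift; _⊔_)
open import Data.Product using (Σ; ∃; _×_; _,_; proj₁; proj₂)
open import Data.Sum.Base using (_⊎_; inj₁; inj₂; [_,_]′)
open import Data.Bool.Base as Bool using (Bool; true; false; T; not)
open import Data.Bool.Properties as Bool using (T-≡; T-∧; ⇔→≡)
open import Function.Base using (_∘_; id)
open import Function.Bundles using (_⇔_; mk⇔; Equivalence)
open import Function.Properties.Equivalence using () renaming (sym to ⇔-sym; trans to ⇔-trans)
open import Algebra.Lattice.Bundles using (BooleanAlgebra)
import Algebra.Lattice.Properties.BooleanAlgebra as BooleanAlgebraProperties
open import Axiom.ExcludedMiddle using (ExcludedMiddle)
open import Axiom.Extensionality.Propositional using (Extensionality)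
import Relation.Binary.Lattice.Properties.MeetSemilattice as MeetSemilatticeProperties
import Relation.Binary.Lattice as OrderTheoretic
import Relation.Binary.Reasoning.Setoid as SetoidReasoning
open import Relation.Binary.PropositionalEquality as ≡ using (_≡_)
open import Relation.Nullary.Decidable
  using (Dec; yes; no; ⌊_⌋; toWitness; fromWitness; decidable-stable)
open import Relation.Nullary.Negation using (contradiction) renaming (¬_ to Not)
open import Relation.Unary using (Pred)

private
  variable
    a c ℓ p : Level

-- Subsets are Bool-valued, so that by excluded middle the power set of A lives in
-- the universe of A; the tower below quantifies over it without raising levels.

Subset : Set a → Set a
Subset A = A → Bool

module _ {A : Set a} where
  infix 4 _∈_ _∉_ _⊆_

  _∈_ _∉_ : A → Subset A → Set
  x ∈ X = T (X x)
  x ∉ X = Not (x ∈ X)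

  _⊆_ : Subset A → Subset A → Set a
  X ⊆ Y = ∀ {x} → x ∈ X → x ∈ Y

IsChain : {A : Set a} → Subset (Subset A) → Set a
IsChain S = ∀ {X Y} → X ∈ S → Y ∈ S → X ⊆ Y ⊎ Y ⊆ X

T-ext : ∀ {x y} → T x ⇔ T y → x ≡ y
T-ext Tx⇔Ty = ⇔→≡ (⇔-trans (⇔-sym T-≡) (⇔-trans Tx⇔Ty T-≡))

Not-T : ∀ {x} → Not (T x) ⇔ T (not x)
Not-T {true}  = mk⇔ (λ ¬⊤ → ¬⊤ _) (λ ())
Not-T {false} = mk⇔ _ (λ _ ())

-- Order in a Boolean algebra.

module BooleanOrder (𝓐 : BooleanAlgebra c ℓ) where
  open BooleanAlgebra 𝓐
  open BooleanAlgebraProperties 𝓐 public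
  open OrderTheoretic.Lattice ∨-∧-orderTheoreticLattice public
    using (_≤_; x∧y≤x; x∧y≤y; ∧-greatest; antisym)
    renaming (refl to ≤-refl; trans to ≤-trans; reflexive to ≤-reflexive)
  open MeetSemilatticeProperties
    (OrderTheoretic.Lattice.meetSemilattice ∨-∧-orderTheoreticLattice) public
    using (∧-monotonic)
  open SetoidReasoning setoid

  x∧¬y≈⊥⇒x≤y : ∀ {x y} → x ∧ ¬ y ≈ ⊥ → x ≤ y
  -- The order `x ≤ y` unfolds to `x ≈ x ∧ y`, so this chain of equations is already the inequality.
  x∧¬y≈⊥⇒x≤y {x} {y} x∧¬y≈⊥ = begin
    x                      ≈⟨ ∧-identityʳ x ⟨
    x ∧ ⊤                  ≈⟨ ∧-congˡ (∨-complementʳ y) ⟨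
    x ∧ (y ∨ ¬ y)          ≈⟨ ∧-distribˡ-∨ x y (¬ y) ⟩
    (x ∧ y) ∨ (x ∧ ¬ y)    ≈⟨ ∨-congˡ x∧¬y≈⊥ ⟩
    (x ∧ y) ∨ ⊥            ≈⟨ ∨-identityʳ (x ∧ y) ⟩
    x ∧ y                  ∎

  x∧y≈⊥⇒x≤¬y : ∀ {x y} → x ∧ y ≈ ⊥ → x ≤ ¬ y
  x∧y≈⊥⇒x≤¬y {x} {y} x∧y≈⊥ =
    x∧¬y≈⊥⇒x≤y (trans (∧-congˡ (¬-involutive y)) x∧y≈⊥)

  ≤⊥⇒≈⊥ : ∀ {x} → x ≤ ⊥ → x ≈ ⊥
  ≤⊥⇒≈⊥ x≤⊥ = trans x≤⊥ (∧-zeroʳ _)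

not-∧-not : ∀ x y → not (not x Bool.∧ not y) ≡ x Bool.∨ y
not-∧-not true  _ = ≡.refl
not-∧-not false y = Bool.not-involutive y

-- Proper filters and two-valued homomorphisms.

module _ (𝓐 : BooleanAlgebra c ℓ) where
  open BooleanAlgebra 𝓐
  open BooleanOrder 𝓐

  -- The empty subset qualifies, so inhabitation is a separate hypothesis in `maximal⇒prime`.
  record IsProperFilter (F : Subset Carrier) : Set (c ⊔ ℓ) where
    field
      upward : ∀ {x y} → x ≤ y → x ∈ F → y ∈ F
      meet   : ∀ {x y} → x ∈ F → y ∈ F → x ∧ y ∈ F
      proper : ⊥ ∉ F

  record IsBooleanHomomorphism (χ : Carrier → Bool) : Set (c ⊔ ℓ) where
    field
      cong   : ∀ {x y} → x ≈ y → χ x ≡ χ y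
      ∧-homo : ∀ x y → χ (x ∧ y) ≡ χ x Bool.∧ χ y
      ¬-homo : ∀ x → χ (¬ x) ≡ not (χ x)

    ∨-homo : ∀ x y → χ (x ∨ y) ≡ χ x Bool.∨ χ y
    ∨-homo x y = begin
      χ (x ∨ y)                        ≡⟨ cong (∨-cong (¬-involutive x) (¬-involutive y)) ⟨
      χ (¬ ¬ x ∨ ¬ ¬ y)                ≡⟨ cong (deMorgan₁ (¬ x) (¬ y)) ⟨
      χ (¬ (¬ x ∧ ¬ y))                ≡⟨ ¬-homo (¬ x ∧ ¬ y) ⟩
      not (χ (¬ x ∧ ¬ y))              ≡⟨ ≡.cong not (∧-homo (¬ x) (¬ y)) ⟩
      not (χ (¬ x) Bool.∧ χ (¬ y))     ≡⟨ ≡.cong not (≡.cong₂ Bool._∧_ (¬-homo x) (¬-homo y)) ⟩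
      not (not (χ x) Bool.∧ not (χ y)) ≡⟨ not-∧-not (χ x) (χ y) ⟩
      χ x Bool.∨ χ y                   ∎
      where open ≡.≡-Reasoning

    ⊤-homo : χ ⊤ ≡ true
    ⊤-homo = begin
      χ ⊤                            ≡⟨ cong (∨-complementʳ ⊤) ⟨
      χ (⊤ ∨ ¬ ⊤)                    ≡⟨ ∨-homo ⊤ (¬ ⊤) ⟩
      χ ⊤ Bool.∨ χ (¬ ⊤)             ≡⟨ ≡.cong (χ ⊤ Bool.∨_) (¬-homo ⊤) ⟩
      χ ⊤ Bool.∨ not (χ ⊤)           ≡⟨ Bool.∨-inverseʳ (χ ⊤) ⟩
      true                           ∎
      where open ≡.≡-Reasoning

  module _ {F : Subset Carrier} (isFilter : IsProperFilter F) where
    open IsProperFilter isFilter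

    -- A subset is its own characteristic function. Closure upward and under meets gives `∧-homo`;
    -- for `¬-homo`, properness forbids `x` and `¬ x` together and primeness supplies one of them.
    prime⇒isBooleanHomomorphism : (∀ x → x ∈ F ⊎ ¬ x ∈ F) → IsBooleanHomomorphism F
    prime⇒isBooleanHomomorphism prime = record
      { cong   = λ x≈y → T-ext (mk⇔ (upward (≤-reflexive x≈y))
                                    (upward (≤-reflexive (sym x≈y))))
      ; ∧-homo = λ x y → T-ext (⇔-trans
          (mk⇔ (λ x∧y∈F → upward (x∧y≤x x y) x∧y∈F , upward (x∧y≤y x y) x∧y∈F)
               (λ (x∈F , y∈F) → meet x∈F y∈F))
          (⇔-sym T-∧))
      ; ¬-homo = ¬-homo
      }
      where
      ¬-homo : ∀ x → F (¬ x) ≡ not (F x)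
      ¬-homo x = T-ext (⇔-trans
          (mk⇔ disjoint λ x∉F → [ (λ x∈F → contradiction x∈F x∉F) , id ]′ (prime x))
          Not-T)
        where
        disjoint : ¬ x ∈ F → x ∉ F
        disjoint ¬x∈F x∈F = proper (upward (≤-reflexive (∧-complementʳ x)) (meet x∈F ¬x∈F))

module Classical (em : ∀ a → ExcludedMiddle a) (ext : ∀ a b → Extensionality a b) where

  -- Comprehension: excluded middle at level `p` decides the predicate, so the resulting subset no
  -- longer depends on `p`.
  ⟦_⟧ : {A : Set a} → Pred A p → Subset A
  ⟦ P ⟧ x = ⌊ em _ {P x} ⌋

  -- Zorn's lemma for families of subsets.

  module _ {A : Set a} where

    ⊆-antisym : {X Y : Subset A} → X ⊆ Y → Y ⊆ X → X ≡ Y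
    ⊆-antisym X⊆Y Y⊆X = ext _ _ λ _ → T-ext (mk⇔ X⊆Y Y⊆X)

    ⋃ : Subset (Subset A) → Subset A
    ⋃ S = ⟦ (λ x → ∃ λ X → X ∈ S × x ∈ X) ⟧

    ⋃-upper : ∀ {S X} → X ∈ S → X ⊆ ⋃ S
    ⋃-upper X∈S x∈X = fromWitness (_ , X∈S , x∈X)

    ⋃-least : ∀ {S Y} → (∀ {X} → X ∈ S → X ⊆ Y) → ⋃ S ⊆ Y
    ⋃-least S⊆Y x∈⋃S with X , X∈S , x∈X ← toWitness x∈⋃S = S⊆Y X∈S x∈X

    module Tower (grow : Subset A → Subset A) (grow-upper : ∀ X → X ⊆ grow X)
                 (base : Subset A) where

      -- Unions range over arbitrary inhabited sets of stages; that these are chains is proved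
      -- afterwards, in `total`. Inhabitation keeps `base` inside every union.
      data Stage : Pred (Subset A) a where
        start : Stage base
        step  : ∀ {X} → Stage X → Stage (grow X)
        union : ∀ {S} → ∃ (_∈ S) → (∀ {X} → X ∈ S → Stage X) → Stage (⋃ S)

      base⊆ : ∀ {X} → Stage X → base ⊆ X
      base⊆ start                   = id
      base⊆ (step {X} s)            = grow-upper X ∘ base⊆ s
      base⊆ (union (X , X∈S) stage) = ⋃-upper X∈S ∘ base⊆ (stage X∈S)

      -- The induction is on both stages at once: comparing grow X with Y uses the
      -- comparisons of X with Y and, with the roles exchanged, of Y with X.

      compare : ∀ {X Y} → Stage X → Stage Y → X ⊆ Y ⊎ grow Y ⊆ X
      step-⊆  : ∀ {X Y} → Stage X → Stage Y → X ⊆ Y → grow X ⊆ Y ⊎ grow Y ⊆ grow X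

      compare start        t = inj₁ (base⊆ t)
      compare (step {X} s) t with compare s t
      ... | inj₁ X⊆Y  = step-⊆ s t X⊆Y
      ... | inj₂ gY⊆X = inj₂ (grow-upper X ∘ gY⊆X)
      compare {Y = Y} (union {S} _ stage) t
        -- Either one member of `S` already contains `grow Y`, or every member lies in `Y` and hence
        -- so does the union.
        with em _ {∃ λ X → X ∈ S × grow Y ⊆ X}
      ... | yes (X , X∈S , gY⊆X) = inj₂ (⋃-upper X∈S ∘ gY⊆X)
      ... | no  none             = inj₁ (⋃-least λ X∈S →
        [ id , (λ gY⊆X → contradiction (_ , X∈S , gY⊆X) none) ]′ (compare (stage X∈S) t))

      step-⊆ {X} {Y} s t X⊆Y with compare t s
      ... | inj₂ gX⊆Y = inj₁ gX⊆Y
      -- Mutual inclusion becomes propositional equality by extensionality, which identifies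
      -- `grow X` with `grow Y`.
      ... | inj₁ Y⊆X with ≡.refl ← ⊆-antisym {X} {Y} X⊆Y Y⊆X = inj₂ id

      total : ∀ {X Y} → Stage X → Stage Y → X ⊆ Y ⊎ Y ⊆ X
      total {Y = Y} s t with compare s t
      ... | inj₁ X⊆Y  = inj₁ X⊆Y
      ... | inj₂ gY⊆X = inj₂ (gY⊆X ∘ grow-upper Y)

      top : Subset A
      top = ⋃ ⟦ Stage ⟧

      top-stage : Stage top
      top-stage = union (base , fromWitness start) toWitness

      -- `top` is itself a stage, so `grow top` is one of the sets whose union is `top`.
      grow-top : grow top ⊆ top
      grow-top = ⋃-upper (fromWitness (step top-stage))

    module _ (P : Pred (Subset A) p) where

      ProperExtension : Subset A → Set (a ⊔ p)
      ProperExtension X = ∃ λ Y → P Y × X ⊆ Y × Not (Y ⊆ X)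

      -- Let `grow` pass to a proper extension satisfying `P` whenever one exists. The top of the
      -- tower above the given set cannot grow, hence is maximal.
      zorn : (∀ {S} → ∃ (_∈ S) → IsChain S → (∀ {X} → X ∈ S → P X) → P (⋃ S)) →
             ∀ {X} → P X →
             ∃ λ M → X ⊆ M × P M × (∀ {Y} → P Y → M ⊆ Y → Y ⊆ M)
      zorn P-⋃ {B} PB =
        top , base⊆ top-stage , stage⇒P top-stage , grow⊆⇒maximal grow-top
        where
        -- A positive decision carries its witness, so `em` acts as the choice function.
        choose : ∀ {X} → Dec (ProperExtension X) → Subset A
        choose (yes (Y , _)) = Y
        choose {X} (no _)    = X

        grow : Subset A → Subset A
        grow X = choose (em _ {ProperExtension X})

        grow-upper : ∀ X → X ⊆ grow X
        grow-upper X with em _ {ProperExtension X}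
        ... | yes (_ , _ , X⊆Y , _) = X⊆Y
        ... | no  _                 = id

        grow-P : ∀ {X} → P X → P (grow X)
        grow-P {X} PX with em _ {ProperExtension X}
        ... | yes (_ , PY , _) = PY
        ... | no  _            = PX

        grow⊆⇒maximal : ∀ {X} → grow X ⊆ X → ∀ {Y} → P Y → X ⊆ Y → Y ⊆ X
        grow⊆⇒maximal {X} gX⊆X PY X⊆Y with em _ {ProperExtension X}
        ... | yes (_ , _ , _ , Z⊈X) = contradiction (λ {x} → gX⊆X {x}) Z⊈X
        ... | no  none              =
          decidable-stable (em _) λ Y⊈X → none (_ , PY , X⊆Y , Y⊈X)

        open Tower grow grow-upper B

        stage⇒P : ∀ {X} → Stage X → P X
        stage⇒P start                  = PB
        stage⇒P (step s)               = grow-P (stage⇒P s)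
        stage⇒P (union nonempty stage) =
          P-⋃ nonempty (λ X∈S Y∈S → total (stage X∈S) (stage Y∈S))
              (λ X∈S → stage⇒P (stage X∈S))

  module _ (𝓐 : BooleanAlgebra c ℓ) where
    open BooleanAlgebra 𝓐
    open BooleanOrder 𝓐

    ⋃-isProperFilter : ∀ {S} → ∃ (_∈ S) → IsChain S →
                       (∀ {F} → F ∈ S → IsProperFilter 𝓐 F) → IsProperFilter 𝓐 (⋃ S)
    ⋃-isProperFilter {S} _ chain filters = record
      { upward = λ x≤y x∈⋃S →
          let F , F∈S , x∈F = toWitness x∈⋃S
          in ⋃-upper F∈S (upward (filters F∈S) x≤y x∈F)
      ; meet   = meet-⋃
      ; proper = λ ⊥∈⋃S →
          let _ , F∈S , ⊥∈F = toWitness ⊥∈⋃S in proper (filters F∈S) ⊥∈F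
      }
      where
      open IsProperFilter
      meet-⋃ : ∀ {x y} → x ∈ ⋃ S → y ∈ ⋃ S → x ∧ y ∈ ⋃ S
      meet-⋃ x∈⋃S y∈⋃S with toWitness x∈⋃S | toWitness y∈⋃S
      -- The two elements may come from different filters; the larger one contains both.
      ... | F , F∈S , x∈F | G , G∈S , y∈G with chain F∈S G∈S
      ... | inj₁ F⊆G = ⋃-upper G∈S (meet (filters G∈S) (F⊆G x∈F) y∈G)
      ... | inj₂ G⊆F = ⋃-upper F∈S (meet (filters F∈S) x∈F (G⊆F y∈G))

    ↑_ : Carrier → Subset Carrier
    ↑ x = ⟦ x ≤_ ⟧

    ↑-isProperFilter : ∀ {x} → Not (x ≈ ⊥) → IsProperFilter 𝓐 (↑ x)
    ↑-isProperFilter x≉⊥ = record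
      { upward = λ y≤z x≤y → fromWitness (≤-trans (toWitness x≤y) y≤z)
      ; meet   = λ x≤y x≤z → fromWitness (∧-greatest (toWitness x≤y) (toWitness x≤z))
      ; proper = λ x≤⊥ → x≉⊥ (≤⊥⇒≈⊥ (toWitness x≤⊥))
      }

    module _ {F : Subset Carrier} (isFilter : IsProperFilter 𝓐 F) where
      open IsProperFilter isFilter

      -- For inhabited `F`, the filter generated by `F` and `x`.
      adjoin : Carrier → Subset Carrier
      adjoin x = ⟦ (λ z → ∃ λ y → y ∈ F × y ∧ x ≤ z) ⟧

      adjoin-isProperFilter : ∀ {x} → (∀ {y} → y ∈ F → Not (y ∧ x ≈ ⊥)) →
                              IsProperFilter 𝓐 (adjoin x)
      adjoin-isProperFilter {x} compatible = record
        { upward = λ z≤w z∈ →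
            let y , y∈F , yx≤z = toWitness z∈
            in fromWitness (y , y∈F , ≤-trans yx≤z z≤w)
        ; meet   = λ z∈ w∈ →
            let y , y∈F , yx≤z = toWitness z∈
                v , v∈F , vx≤w = toWitness w∈
            in fromWitness (y ∧ v , meet y∈F v∈F , ∧-greatest
                 (≤-trans (∧-monotonic (x∧y≤x y v) ≤-refl) yx≤z)
                 (≤-trans (∧-monotonic (x∧y≤y y v) ≤-refl) vx≤w))
        ; proper = λ ⊥∈ →
            let y , y∈F , yx≤⊥ = toWitness ⊥∈ in compatible y∈F (≤⊥⇒≈⊥ yx≤⊥)
        }

      -- If some member of `F` is disjoint from `x`, it lies below `¬ x`. Otherwise `adjoin x` is a
      -- proper filter extending `F`, and maximality puts `x` into `F`.
      maximal⇒prime : ∃ (_∈ F) → (∀ {G} → IsProperFilter 𝓐 G → F ⊆ G → G ⊆ F) →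
                      ∀ x → x ∈ F ⊎ ¬ x ∈ F
      maximal⇒prime (y , y∈F) maximal x with em _ {∃ λ y → y ∈ F × y ∧ x ≈ ⊥}
      ... | yes (y , y∈F , yx≈⊥) = inj₂ (upward (x∧y≈⊥⇒x≤¬y yx≈⊥) y∈F)
      ... | no  none             = inj₁ (maximal
        (adjoin-isProperFilter λ y∈F yx≈⊥ → none (_ , y∈F , yx≈⊥))
        (λ z∈F → fromWitness (_ , z∈F , x∧y≤x _ x))
        (fromWitness (y , y∈F , x∧y≤y y x)))

    ultrafilter : ∀ {x} → Not (x ≈ ⊥) → ∃ λ χ → IsBooleanHomomorphism 𝓐 χ × χ x ≡ true
    ultrafilter {x} x≉⊥
      with U , ↑x⊆U , isFilter , maximal
             ← zorn (IsProperFilter 𝓐) ⋃-isProperFilter (↑-isProperFilter x≉⊥)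
      = let x∈U = ↑x⊆U (fromWitness ≤-refl) in
        U
      , prime⇒isBooleanHomomorphism 𝓐 isFilter (maximal⇒prime isFilter (x , x∈U) maximal)
      , Equivalence.to T-≡ x∈U

    homomorphisms-reflect-≤ : ∀ {x y} →
      (∀ {χ} → IsBooleanHomomorphism 𝓐 χ → χ x ≡ χ y) → x ≤ y
    homomorphisms-reflect-≤ {x} {y} χx≡χy = x∧¬y≈⊥⇒x≤y (decidable-stable (em _) separated)
      where
      open ≡.≡-Reasoning
      separated : Not (Not (x ∧ ¬ y ≈ ⊥))
      -- A homomorphism true at `x ∧ ¬ y` is true at `x` and false at `y`, against the assumed
      -- agreement.
      separated x∧¬y≉⊥ with χ , isHom , χ[x∧¬y]≡true ← ultrafilter x∧¬y≉⊥ =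
        contradiction (begin
          true                  ≡⟨ χ[x∧¬y]≡true ⟨
          χ (x ∧ ¬ y)           ≡⟨ ∧-homo x (¬ y) ⟩
          χ x Bool.∧ χ (¬ y)    ≡⟨ ≡.cong₂ Bool._∧_ (χx≡χy isHom) (¬-homo y) ⟩
          χ y Bool.∧ not (χ y)  ≡⟨ Bool.∧-inverseʳ (χ y) ⟩
          false                 ∎) λ ()
        where open IsBooleanHomomorphism isHom

    homomorphisms-separate : ∀ {x y} →
      (∀ {χ} → IsBooleanHomomorphism 𝓐 χ → χ x ≡ χ y) → x ≈ y
    homomorphisms-separate χx≡χy = antisym (homomorphisms-reflect-≤ χx≡χy)
      (homomorphisms-reflect-≤ (λ isHom → ≡.sym (χx≡χy isHom)))

theorem9p12 : (∀ a → ExcludedMiddle a) →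
    (∀ a b → Extensionality a b) →
    ∀ {c ℓ p} (𝓐 : BooleanAlgebra c ℓ) (B : SwapStructure 𝓐 p) →
    Σ (Set (c ⊔ ℓ ⊔ p)) λ I →
    Σ (ΣAlgebra.Carrier (algebra B) → ΣAlgebra.Carrier (∏ I (λ _ → 𝓑-LFI1∘ 𝔸₂))) λ h →
    IsMonomorphism (algebra B) (∏ I (λ _ → 𝓑-LFI1∘ 𝔸₂)) h
theorem9p12 em ext {p = p} 𝓐 B = I , h , record
  { isHomomorphism = record
    { cong      = λ (z₁≈w₁ , z₂≈w₂) (_ , lift hom) → cong hom z₁≈w₁ , cong hom z₂≈w₂
    ; ∧-homo    = λ _ _ (_ , lift hom) → ∧-homo hom _ _ , ∨-homo hom _ _
    ; ∨-homo    = λ _ _ (_ , lift hom) → ∨-homo hom _ _ , ∧-homo hom _ _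
    ; ⇒-homo    = λ ((z₁ , _) , _) _ (χ , lift hom) →
        ≡.trans (∨-homo hom _ _) (≡.cong (Bool._∨ _) (¬-homo hom z₁)) , ∧-homo hom _ _
    ; neg-homo  = λ _ _ → ≡.refl , ≡.refl
    ; circ-homo = λ _ (_ , lift hom) →
        ≡.trans (¬-homo hom _) (≡.cong not (∧-homo hom _ _)) , ∧-homo hom _ _
    }
  -- Domain elements are compared as pairs, so separating each coordinate suffices.
  ; injective = λ hz≈hw →
        homomorphisms-separate 𝓐 (λ hom → proj₁ (hz≈hw (_ , lift hom)))
      , homomorphisms-separate 𝓐 (λ hom → proj₂ (hz≈hw (_ , lift hom)))
  }
  where
  open Classical em ext
  open IsBooleanHomomorphism

  -- `Lift p` only adjusts the universe level. Over the one-element algebra `I` is empty and the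
  -- product is a single point.
  I : Set _
  I = ∃ λ χ → Lift p (IsBooleanHomomorphism 𝓐 χ)

  h : ΣAlgebra.Carrier (algebra B) → ΣAlgebra.Carrier (∏ I (λ _ → 𝓑-LFI1∘ 𝔸₂))
  h ((z₁ , z₂) , z∈) (χ , lift hom) = (χ z₁ , χ z₂) ,
    -- The image satisfies `Bciw` because `χ` carries `z₁ ∨ z₂ ≈ ⊤` to `true`.
    ≡.trans (≡.sym (∨-homo hom z₁ z₂))
            (≡.trans (cong hom (SwapStructure.domain⊆ B z∈)) (⊤-homo hom))
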